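{- Let $d\geq 1$ and let $D$ be an oriented graph of minimum semi-degree $d$ and of order $n=md$, where $2.91082<m\leq 3$. If the strong connectivity $k$ of $D$ satisfies $k\leq 0.679\,d$, then $D$ contains at least one directed triangle.
   Context: Digraphs have no loops and no parallel arcs. An oriented graph is a digraph in which for any two distinct vertices $x,y$ at most one of $(x,y),(y,x)$ is an arc. The minimum semi-degree of $D$ is the minimum of its minimum out-degree and its minimum in-degree. A set $S$ of vertices disconnects $D$ if $D-S$ is not strongly connected; the strong connectivity of $D$ is the smallest cardinality of a vertex set disconnecting $D$. A directed triangle is a directed cycle of length $3$. -}

module Defs where

open import Data.Nat using (ℕ; _≤_; _<_; _*_)
open import Data.Bool using (Bool; true; false)
open import Data.Fin using (Fin)
open import Data.Fin.Subset using (Subset; _∈_; _∉_; ∣_∣)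
open import Data.Vec using (tabulate)
open import Data.Product using (_×_; ∃; ∃-syntax; Σ-syntax)
open import Data.Sum using (_⊎_)
open import Relation.Binary.PropositionalEquality using (_≡_)
open import Relation.Nullary using (¬_)

record Digraph (n : ℕ) : Set where
  field
    arc    : Fin n → Fin n → Bool
    noLoop : ∀ x → arc x x ≡ false

open Digraph public

Oriented : ∀ {n} → Digraph n → Set
Oriented D = ∀ x y → ¬ (arc D x y ≡ true × arc D y x ≡ true)

outNbhd : ∀ {n} → Digraph n → Fin n → Subset n
outNbhd D x = tabulate (λ y → arc D x y)

inNbhd : ∀ {n} → Digraph n → Fin n → Subset n
inNbhd D x = tabulate (λ y → arc D y x)

outDeg : ∀ {n} → Digraph n → Fin n → ℕ
outDeg D x = ∣ outNbhd D x ∣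

inDeg : ∀ {n} → Digraph n → Fin n → ℕ
inDeg D x = ∣ inNbhd D x ∣

MinSemiDegree : ∀ {n} → Digraph n → ℕ → Set
MinSemiDegree {n} D d =
  (∀ x → d ≤ outDeg D x × d ≤ inDeg D x) ×
  (∃[ x ] (outDeg D x ≡ d ⊎ inDeg D x ≡ d))

data PathAvoiding {n} (D : Digraph n) (S : Subset n) : Fin n → Fin n → Set where
  here : ∀ {x} → PathAvoiding D S x x
  step : ∀ {x y z} → arc D x y ≡ true → y ∉ S → PathAvoiding D S y z → PathAvoiding D S x z

StronglyConnectedMinus : ∀ {n} → Digraph n → Subset n → Set
StronglyConnectedMinus D S = ∀ x y → x ∉ S → y ∉ S → PathAvoiding D S x y

Disconnects : ∀ {n} → Digraph n → Subset n → Set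
Disconnects D S = ¬ StronglyConnectedMinus D S

IsStrongConnectivity : ∀ {n} → Digraph n → ℕ → Set
IsStrongConnectivity {n} D k =
  (∃[ S ] (Disconnects D S × ∣ S ∣ ≡ k)) ×
  (∀ (S : Subset n) → Disconnects D S → k ≤ ∣ S ∣)

-- D contains a directed triangle (distinctness of x,y,z follows from noLoop + orientation)
HasDirectedTriangle : ∀ {n} → Digraph n → Set
HasDirectedTriangle D =
  ∃[ x ] ∃[ y ] ∃[ z ] (arc D x y ≡ true × arc D y z ≡ true × arc D z x ≡ true)

{-# OPTIONS --safe #-}
module Submission where

-- Suppose there is no directed triangle. By Shen's argument (sum, over all arcs u → v, the fact
-- that N⁻(u) ∪ N⁻(v) misses N⁺(w) ∪ (N⁺(u) ∩ N⁺(v)) for a suitable w), every nonempty vertex set X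
-- has a vertex with fewer than 4|X|/11 out-neighbours in X, and dually for in-neighbours.
-- Let S be a set of k ≤ 9d/13 vertices and V ∖ S = A ∪ B without arcs from A to B. Take u ∈ A with
-- few out-neighbours in A, then y of small out-degree inside R = N⁺(u) ∩ A: the arcs leaving y
-- force T = N⁻(u) ∩ B to be large. Take z of small in-degree inside T: its in-neighbours in S
-- avoid N⁺(u), so B is large. This bound on |A|, |B|, k and its dual add up to
-- k ≥ 73d/105 > 9d/13.

open import Defs
open import Data.Bool using (Bool; true; false; _∧_; _∨_; not; if_then_else_)
import Data.Bool.Properties as Bool
open import Data.Empty using (⊥; ⊥-elim)
open import Data.Fin as Fin using (Fin; zero; suc)
open import Data.Fin.Properties using (any?)
open import Data.Fin.Subset using (Subset; _∉_; ∣_∣)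
open import Data.Nat using (ℕ; zero; suc; _+_; _*_; _≤_; _<_; z≤n; s≤s; _≤?_; _<?_)
open import Data.Nat.Properties
open import Data.Nat.Tactic.RingSolver using (solve-∀)
open import Data.Product using (_×_; _,_; ∃-syntax; proj₁; proj₂)
open import Data.Sum using (inj₁; inj₂)
open import Data.Vec using (tabulate; lookup)
open import Data.Vec.Properties using (lookup⇒[]=; []=⇒lookup; tabulate∘lookup)
open import Function using (_∘_; flip)
open import Relation.Binary.PropositionalEquality using (_≡_; refl; sym; trans; cong; cong₂; subst; subst₂)
open import Relation.Nullary using (¬_; Dec; yes; no; does)
open import Relation.Nullary.Decidable using (True; toWitness; map′; _×-dec_; _→-dec_; decidable-stable)
open import Algebra.Properties.Semiring.Sum +-*-semiring using (sum; sum-cong-≗; ∑-distrib-+; ∑-comm; *-distribˡ-sum; *-distribʳ-sum)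

-- Indicators, truth tables and elementary inequalities

⟦_⟧ : Bool → ℕ
⟦ b ⟧ = if b then 1 else 0

-- Lets a claim about finitely many Booleans be proved by evaluating its truth table with
-- `toWitness`. The pointwise inequalities below are of this kind and are then summed over all
-- vertices.
∀ᵇ : {P : Bool → Set} → (∀ b → Dec (P b)) → Dec (∀ b → P b)
∀ᵇ P? = map′ (λ { (p , q) true → p ; (p , q) false → q }) (λ p → p true , p false)
             (P? true ×-dec P? false)

⟦∧⟧ : ∀ b c → ⟦ b ∧ c ⟧ ≡ ⟦ b ⟧ * ⟦ c ⟧
⟦∧⟧ = toWitness {a? = ∀ᵇ λ b → ∀ᵇ λ c → ⟦ b ∧ c ⟧ ≟ ⟦ b ⟧ * ⟦ c ⟧} _

contradictory : ∀ {b} → b ≡ true → b ≡ false → ⊥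
contradictory refl ()

-- Common shape of the linear eliminations: `l ≤ r` is a nonnegative combination of known
-- inequalities, and `z` is the part shared by both sides, split off by the ring solver.
cancel : ∀ z {l r L R} → l ≤ r → l ≡ z + L → r ≡ z + R → L ≤ R
cancel z {L = L} {R} p q s = +-cancelˡ-≤ z L R (subst₂ _≤_ q s p)

*-absurd : ∀ p q d {_ : True (p <? q)} → 1 ≤ d → q * d ≤ p * d → ⊥
*-absurd p q (suc d) {p<q} _ le = <⇒≱ (toWitness p<q) (*-cancelʳ-≤ q p (suc d) le)

ratio-absurd : ∀ p q r s d k {_ : True (q * s <? r * p)} →
               1 ≤ d → p * d ≤ q * k → r * k ≤ s * d → ⊥
ratio-absurd p q r s d k {lt} 1≤d pd≤qk rk≤sd = *-absurd (q * s) (r * p) d {lt} 1≤d (begin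
  r * p * d   ≡⟨ *-assoc r p d ⟩
  r * (p * d) ≤⟨ *-monoʳ-≤ r pd≤qk ⟩
  r * (q * k) ≡⟨ exchange r q k ⟩
  q * (r * k) ≤⟨ *-monoʳ-≤ q rk≤sd ⟩
  q * (s * d) ≡⟨ *-assoc q s d ⟨
  q * s * d   ∎)
  where
  open ≤-Reasoning
  exchange : ∀ x y z → x * (y * z) ≡ y * (x * z)
  exchange = solve-∀

2ab≤a²+b² : ∀ a b → 2 * (a * b) ≤ a * a + b * b
2ab≤a²+b² a b with ≤-total a b
... | inj₁ a≤b with m≤n⇒∃[o]m+o≡n a≤b
...   | e , refl = m+n≤o⇒m≤o _ (≤-reflexive (eq a e))
  where
  eq : ∀ a e → 2 * (a * (a + e)) + e * e ≡ a * a + (a + e) * (a + e)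
  eq = solve-∀
2ab≤a²+b² a b | inj₂ b≤a with m≤n⇒∃[o]m+o≡n b≤a
...   | e , refl = m+n≤o⇒m≤o _ (≤-reflexive (eq b e))
  where
  eq : ∀ b e → 2 * ((b + e) * b) + e * e ≡ (b + e) * (b + e) + b * b
  eq = solve-∀

-- Finite sums and counting

-- The library's sum reduces to a fold, which blocks the inference of summands; hence opaque.
opaque
  ∑ : ∀ {n} → (Fin n → ℕ) → ℕ
  ∑ = sum

  ∑-cong : ∀ {n} {f g : Fin n → ℕ} → (∀ i → f i ≡ g i) → ∑ f ≡ ∑ g
  ∑-cong = sum-cong-≗

  ∑-mono : ∀ {n} {f g : Fin n → ℕ} → (∀ i → f i ≤ g i) → ∑ f ≤ ∑ g
  ∑-mono {zero}  p = z≤n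
  ∑-mono {suc n} p = +-mono-≤ (p zero) (∑-mono (p ∘ suc))

  ∑-const : ∀ n c → ∑ {n} (λ _ → c) ≡ n * c
  ∑-const zero    c = refl
  ∑-const (suc n) c = cong (c +_) (∑-const n c)

  ∑-+ : ∀ {n} (f g : Fin n → ℕ) → ∑ (λ i → f i + g i) ≡ ∑ f + ∑ g
  ∑-+ = ∑-distrib-+

  ∑-swap : ∀ {m n} (f : Fin m → Fin n → ℕ) → ∑ (λ i → ∑ (f i)) ≡ ∑ (λ j → ∑ (λ i → f i j))
  ∑-swap = ∑-comm

  *-∑ : ∀ {n} c (f : Fin n → ℕ) → c * ∑ f ≡ ∑ (λ i → c * f i)
  *-∑ = *-distribˡ-sum

  ∑-* : ∀ {n} c (f : Fin n → ℕ) → ∑ f * c ≡ ∑ (λ i → f i * c)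
  ∑-* = *-distribʳ-sum

∑-+₃ : ∀ {n} (f g h : Fin n → ℕ) →
               ∑ (λ i → f i + g i + h i) ≡ ∑ f + ∑ g + ∑ h
∑-+₃ f g h =
  trans (∑-+ (λ i → f i + g i) h) (cong (_+ ∑ h) (∑-+ f g))

∑-+₄ : ∀ {n} (f g h k : Fin n → ℕ) →
               ∑ (λ i → f i + g i + h i + k i) ≡ ∑ f + ∑ g + ∑ h + ∑ k
∑-+₄ f g h k =
  trans (∑-+ (λ i → f i + g i + h i) k) (cong (_+ ∑ k) (∑-+₃ f g h))

∑₂-cong : ∀ {m n} {g k : Fin m → Fin n → ℕ} → (∀ u v → g u v ≡ k u v) →
            ∑ (λ u → ∑ (g u)) ≡ ∑ (λ u → ∑ (k u))
∑₂-cong eq = ∑-cong λ u → ∑-cong (eq u)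

∑₂-scale : ∀ {m n} c (g : Fin m → Fin n → ℕ) →
             ∑ (λ u → ∑ λ v → c * g u v) ≡ c * ∑ (λ u → ∑ (g u))
∑₂-scale c g = sym (trans (*-∑ c _) (∑-cong λ u → *-∑ c (g u)))

∑₂-+ : ∀ {m n} (g k : Fin m → Fin n → ℕ) →
         ∑ (λ u → ∑ λ v → g u v + k u v) ≡ ∑ (λ u → ∑ (g u)) + ∑ (λ u → ∑ (k u))
∑₂-+ g k = trans (∑-cong λ u → ∑-+ (g u) (k u)) (∑-+ _ _)

# : ∀ {n} → (Fin n → Bool) → ℕ
# P = ∑ (λ i → ⟦ P i ⟧)

⟦⟧-positive : ∀ {b} → b ≡ true → 1 ≤ ⟦ b ⟧
⟦⟧-positive refl = ≤-refl

⟦⟧-mono : ∀ {b c} → (b ≡ true → c ≡ true) → ⟦ b ⟧ ≤ ⟦ c ⟧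
⟦⟧-mono {false} f = z≤n
⟦⟧-mono {true}  f = ⟦⟧-positive (f refl)

opaque
  unfolding ∑

  #-positive : ∀ {n} (P : Fin n → Bool) {i} → P i ≡ true → 1 ≤ # P
  #-positive P {zero}  p = ≤-trans (⟦⟧-positive p) (m≤m+n ⟦ P zero ⟧ _)
  #-positive P {suc i} p = ≤-trans (#-positive (P ∘ suc) p) (m≤n+m _ ⟦ P zero ⟧)

  #-< : ∀ {n} (P Q : Fin n → Bool) → (∀ i → P i ≡ true → Q i ≡ true) →
        ∀ {j} → Q j ≡ true → P j ≡ false → # P < # Q
  #-< P Q P⊆Q {zero} q p rewrite p | q = s≤s (∑-mono λ i → ⟦⟧-mono (P⊆Q (suc i)))
  #-< P Q P⊆Q {suc j} q p =
    +-mono-≤-< (⟦⟧-mono (P⊆Q zero)) (#-< (P ∘ suc) (Q ∘ suc) (P⊆Q ∘ suc) q p)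

  ∣tabulate∣ : ∀ {n} (P : Fin n → Bool) → ∣ tabulate P ∣ ≡ # P
  ∣tabulate∣ {zero}  P = refl
  ∣tabulate∣ {suc n} P with P zero
  ... | true  = cong suc (∣tabulate∣ (P ∘ suc))
  ... | false = ∣tabulate∣ (P ∘ suc)

-- Triangle-free relations and their reversal

-- Stated with Boolean equations so that the fields can serve as truth-table hypotheses. For an arc
-- from `x` to `y`, `no-triangle` says that N⁺(y) and N⁻(x) are disjoint.
record TriangleFree {n} (E : Fin n → Fin n → Bool) : Set where
  field
    no-digon    : ∀ x y → E x y ∧ E y x ≡ false
    no-triangle : ∀ {x y} z → E x y ≡ true → E y z ∧ E z x ≡ false

open TriangleFree

reverse : ∀ {n} {E : Fin n → Fin n → Bool} → TriangleFree E → TriangleFree (flip E)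
reverse tf .no-digon x y = no-digon tf y x
reverse {E = E} tf .no-triangle {x} {y} z yx =
  trans (Bool.∧-comm (E z y) (E x z)) (no-triangle tf z yx)

-- Shen's arc count inside a vertex set

-- `F` plays the role of the arcs induced on `X`. By `support`, vertices outside `X` have degree 0,
-- so sums may run over all of `Fin n`.
module ArcCount {n} {F : Fin n → Fin n → Bool} (tf : TriangleFree F)
  (X : Fin n → Bool) (support : ∀ u v → F u v ≡ true → X u ≡ true × X v ≡ true) where

  f : Fin n → Fin n → ℕ
  f u v = ⟦ F u v ⟧

  dout din : Fin n → ℕ
  dout u = # (F u)
  din v  = # (flip F v)

  common⁺ common⁻ : Fin n → Fin n → Fin n → Bool
  common⁺ u v w = F u w ∧ F v w
  common⁻ u v w = F w u ∧ F w v

  -- `M` is the number of arcs; `P` and `Q` are the sums over all arcs u → v of d⁻(v) and d⁻(u)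
  -- respectively.
  h M P Q : ℕ
  h = # X
  M = ∑ λ u → ∑ λ v → f u v
  P = ∑ λ v → din v * din v
  Q = ∑ λ u → din u * dout u

  -- The number of transitive triangles, with source `u`, middle `v` and sink `w`.
  τ : ℕ
  τ = ∑ λ u → ∑ λ v → ∑ λ w → f u v * (f u w * f v w)

  -- For one vertex, the Booleans record membership in `X`, N⁺(w), N⁺(u) ∩ N⁺(v), N⁻(v) and N⁻(u).
  -- This is inclusion-exclusion: only the first two and the last two of the four neighbourhood sets
  -- may overlap.
  arc-pointwise : ∀ x w t v u → w ∧ v ≡ false → w ∧ u ≡ false → t ∧ v ≡ false → t ∧ u ≡ false →
    (w ∨ t ∨ v ∨ u) ∧ not x ≡ false →
    ⟦ w ⟧ + ⟦ t ⟧ + ⟦ v ⟧ + ⟦ u ⟧ ≤ ⟦ x ⟧ + ⟦ t ∧ w ⟧ + ⟦ u ∧ v ⟧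
  arc-pointwise = toWitness {a? = ∀ᵇ λ x → ∀ᵇ λ w → ∀ᵇ λ t → ∀ᵇ λ v → ∀ᵇ λ u →
    (w ∧ v Bool.≟ false) →-dec (w ∧ u Bool.≟ false) →-dec (t ∧ v Bool.≟ false) →-dec
    (t ∧ u Bool.≟ false) →-dec ((w ∨ t ∨ v ∨ u) ∧ not x Bool.≟ false) →-dec
    (⟦ w ⟧ + ⟦ t ⟧ + ⟦ v ⟧ + ⟦ u ⟧ ≤? ⟦ x ⟧ + ⟦ t ∧ w ⟧ + ⟦ u ∧ v ⟧)} _

  covered : ∀ w t v u x → (w ≡ true → x ≡ true) → (t ≡ true → x ≡ true) →
    (v ≡ true → x ≡ true) → (u ≡ true → x ≡ true) → (w ∨ t ∨ v ∨ u) ∧ not x ≡ false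
  covered w t v u true _ _ _ _ = Bool.∧-zeroʳ (w ∨ t ∨ v ∨ u)
  covered true t v u false p _ _ _ = sym (p refl)
  covered false true v u false _ p _ _ = sym (p refl)
  covered false false true u false _ _ p _ = sym (p refl)
  covered false false false true false _ _ _ p = sym (p refl)
  covered false false false false false _ _ _ _ = refl

  ∧-false : ∀ {b c e} → c ∧ e ≡ false → (b ∧ c) ∧ e ≡ false
  ∧-false {false} p = refl
  ∧-false {true}  p = p

  -- N⁺(w) ∪ (N⁺(u) ∩ N⁺(v)) and N⁻(u) ∪ N⁻(v) are disjoint.
  arc-bound : ∀ u v w → F u v ≡ true →
    (∀ i → F w i ∧ F i v ≡ false) → (∀ i → F w i ∧ F i u ≡ false) →
    dout w + # (common⁺ u v) + din v + din u
      ≤ h + # (λ i → common⁺ u v i ∧ F w i) + # (common⁻ u v)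
  arc-bound u v w uv wv wu = subst₂ _≤_ (∑-+₄ _ _ _ _) (∑-+₃ _ _ _)
    (∑-mono λ i → arc-pointwise (X i) (F w i) (common⁺ u v i) (F i v) (F i u)
      (wv i) (wu i)
      (∧-false {F u i} (no-digon tf v i))
      (∧-false {F u i} (no-triangle tf i uv))
      (covered (F w i) (common⁺ u v i) (F i v) (F i u) (X i)
        (proj₂ ∘ support w i) (λ p → proj₂ (support v i (Bool.∧-conicalʳ (F u i) _ p)))
        (proj₁ ∘ support i v) (proj₁ ∘ support i u)))

  arcs-common⁺ : ∑ (λ u → ∑ λ v → f u v * # (common⁺ u v)) ≡ τ
  arcs-common⁺ = ∑₂-cong λ u v → trans (*-∑ (f u v) _)
    (∑-cong λ w → cong (f u v *_) (⟦∧⟧ (F u w) (F v w)))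

  -- A common in-neighbour of an arc is the source of a transitive triangle, so after cyclic
  -- renaming the same triangles are counted.
  arcs-common⁻ : ∑ (λ u → ∑ λ v → f u v * # (common⁻ u v)) ≡ τ
  arcs-common⁻ =
    trans (∑₂-cong λ u v → trans (*-∑ (f u v) _) (∑-cong λ w →
            trans (cong (f u v *_) (⟦∧⟧ (F w u) (F w v))) (shuffle (f u v) (f w u) (f w v))))
    (trans (∑-cong λ u → ∑-swap λ v w → f w u * (f w v * f u v))
           (∑-swap λ u w → ∑ λ v → f w u * (f w v * f u v)))
    where
    shuffle : ∀ a b c → a * (b * c) ≡ b * (c * a)
    shuffle = solve-∀

  arcs-head : ∑ (λ u → ∑ λ v → f u v * din v) ≡ P
  arcs-head = trans (∑-swap λ u v → f u v * din v)
    (∑-cong λ v → sym (∑-* (din v) _))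

  arcs-tail : ∑ (λ u → ∑ λ v → f u v * din u) ≡ Q
  arcs-tail = ∑-cong λ u → trans (sym (∑-* (din u) _)) (*-comm (dout u) (din u))

  M-as-indegrees : M ≡ ∑ din
  M-as-indegrees = ∑-swap f

  -- Grouping by the sink: N⁻(w) spans at most d⁻(w)² / 2 arcs.
  transitive-bound : 2 * τ ≤ P
  transitive-bound = subst₂ _≤_ lhs rhs
    (∑-mono λ w → ∑-mono λ u → ∑-mono λ v →
      pointwise (F u v) (F v u) (F u w) (F v w) (no-digon tf u v))
    where
    pointwise : ∀ a b c e → a ∧ b ≡ false →
      ⟦ a ⟧ * (⟦ c ⟧ * ⟦ e ⟧) + ⟦ b ⟧ * (⟦ e ⟧ * ⟦ c ⟧) ≤ ⟦ c ⟧ * ⟦ e ⟧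
    pointwise = toWitness {a? = ∀ᵇ λ a → ∀ᵇ λ b → ∀ᵇ λ c → ∀ᵇ λ e → (a ∧ b Bool.≟ false) →-dec
      (⟦ a ⟧ * (⟦ c ⟧ * ⟦ e ⟧) + ⟦ b ⟧ * (⟦ e ⟧ * ⟦ c ⟧) ≤? ⟦ c ⟧ * ⟦ e ⟧)} _
    G : Fin n → Fin n → Fin n → ℕ
    G u v w = f u v * (f u w * f v w)
    by-sink : ∑ (λ w → ∑ λ u → ∑ λ v → G u v w) ≡ τ
    by-sink = sym (trans (∑-cong λ u → ∑-swap (G u)) (∑-swap λ u w → ∑ λ v → G u v w))
    by-sink′ : ∑ (λ w → ∑ λ u → ∑ λ v → G v u w) ≡ τ
    by-sink′ = trans (∑-cong λ w → ∑-swap λ u v → G v u w) by-sink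
    lhs : ∑ (λ w → ∑ λ u → ∑ λ v → G u v w + G v u w) ≡ 2 * τ
    lhs = trans (∑-cong λ w → ∑₂-+ (λ u v → G u v w) (λ u v → G v u w))
            (trans (∑-+ (λ w → ∑ λ u → ∑ λ v → G u v w) _)
              (trans (cong₂ _+_ by-sink by-sink′) (cong (τ +_) (sym (+-identityʳ τ)))))
    rhs : ∑ (λ w → ∑ λ u → ∑ λ v → f u w * f v w) ≡ P
    rhs = ∑-cong λ w → trans (∑-cong λ u → sym (*-∑ (f u w) _))
            (sym (∑-* (din w) _))

  no-in-arcs : ∀ v → X v ≡ false → din v ≡ 0
  no-in-arcs v outside =
    n≤0⇒n≡0 (≤-trans (∑-mono zeros) (≤-reflexive (trans (∑-const n 0) (*-zeroʳ n))))
    where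
    zeros : ∀ u → f u v ≤ 0
    zeros u with F u v in uv
    ... | false = z≤n
    ... | true  = ⊥-elim (contradictory (proj₂ (support u v uv)) outside)

  -- The argument works for any ratio above 3 - √7 ≈ 0.3542, a root of c² - 6c + 2; 4/11 is a
  -- convenient rational just above it.
  SmallOutdegree : (Fin n → Bool) → Set
  SmallOutdegree T = ∃[ w ] (T w ≡ true × 11 * # (λ i → T i ∧ F w i) < 4 * # T)

  -- The situation of a minimal counterexample: `X` has no vertex of small out-degree, but every
  -- smaller nonempty set has one.
  module _ (large : ∀ u → X u ≡ true → 4 * h ≤ 11 * dout u)
    (smaller : ∀ T → 1 ≤ # T → # T < h → SmallOutdegree T) where

    -- Take `w` of small out-degree inside the common out-neighbourhood of `u` and `v`: since both
    -- have an arc to `w`, no out-neighbour of `w` has an arc to either. If there is no common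
    -- out-neighbour, `v` itself serves.
    witness : ∀ u v → F u v ≡ true → ∃[ w ] (X w ≡ true ×
      (∀ i → F w i ∧ F i v ≡ false) × (∀ i → F w i ∧ F i u ≡ false) ×
      11 * # (λ i → common⁺ u v i ∧ F w i) ≤ 4 * # (common⁺ u v))
    witness u v uv with 1 ≤? # (common⁺ u v)
    ... | no empty = v , proj₂ (support u v uv) , no-digon tf v , (λ i → no-triangle tf i uv) ,
      ≤-trans (*-monoʳ-≤ 11 (∑-mono λ i → ⟦⟧-mono (Bool.∧-conicalˡ (common⁺ u v i) (F v i))))
        (≤-trans (≤-reflexive (cong (11 *_) (n<1⇒n≡0 (≰⇒> empty)))) z≤n)
    ... | yes pos with smaller (common⁺ u v) pos
                        -- The inclusion in `X` is strict because `v` has no loop.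
                        (#-< (common⁺ u v) X (λ i p → proj₂ (support u i (Bool.∧-conicalˡ _ (F v i) p)))
                             (proj₂ (support u v uv))
                             (trans (cong (F u v ∧_) no-loop) (Bool.∧-zeroʳ (F u v))))
      where
      no-loop : F v v ≡ false
      no-loop = trans (sym (Bool.∧-idem (F v v))) (no-digon tf v v)
    ...   | w , Tw , small = w , proj₂ (support v w vw) ,
              (λ i → no-triangle tf i vw) , (λ i → no-triangle tf i uw) , <⇒≤ small
      where
      uw = Bool.∧-conicalˡ (F u w) (F v w) Tw
      vw = Bool.∧-conicalʳ (F u w) (F v w) Tw

    -- Eleven times `arc-bound`, with d⁺(w) at least 4h/11 and the overlap at most 4/11 of the
    -- common out-neighbourhood; hence 7 = 11 - 4 twice.
    arc-bound′ : ∀ u v → F u v ≡ true →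
      7 * # (common⁺ u v) + 11 * din v + 11 * din u ≤ 7 * h + 11 * # (common⁻ u v)
    arc-bound′ u v uv with witness u v uv
    ... | w , Xw , wv , wu , small =
      finish {dout w} {# (common⁺ u v)} {din v} {din u} {h} {# (λ i → common⁺ u v i ∧ F w i)} {# (common⁻ u v)}
        (arc-bound u v w uv wv wu) (large w Xw) small
      where
      finish : ∀ {o t p q h c s} → o + t + p + q ≤ h + c + s → 4 * h ≤ 11 * o → 11 * c ≤ 4 * t →
               7 * t + 11 * p + 11 * q ≤ 7 * h + 11 * s
      finish {o} {t} {p} {q} {h} {c} {s} a b e =
        cancel (11 * o + 4 * t + 4 * h + 11 * c) (+-mono-≤ (+-mono-≤ (*-monoʳ-≤ 11 a) b) e)
          (l o t p q h c) (r o t h c s)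
        where
        l : ∀ o t p q h c → 11 * (o + t + p + q) + 4 * h + 11 * c ≡
            11 * o + 4 * t + 4 * h + 11 * c + (7 * t + 11 * p + 11 * q)
        l = solve-∀
        r : ∀ o t h c s → 11 * (h + c + s) + 11 * o + 4 * t ≡
            11 * o + 4 * t + 4 * h + 11 * c + (7 * h + 11 * s)
        r = solve-∀

    summed : 7 * τ + 11 * P + 11 * Q ≤ 7 * h * M + 11 * τ
    summed = subst₂ _≤_ lhs rhs (∑-mono λ u → ∑-mono λ v → weighted u v)
      where
      -- The factor `f u v` turns a sum over arcs into a sum over all pairs.
      weighted : ∀ u v →
        7 * (f u v * # (common⁺ u v)) + 11 * (f u v * din v) + 11 * (f u v * din u)
          ≤ 7 * h * f u v + 11 * (f u v * # (common⁻ u v))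
      weighted u v with F u v in uv
      ... | false = z≤n
      ... | true  = subst₂ _≤_ (l (# (common⁺ u v)) (din v) (din u)) (r h (# (common⁻ u v)))
                      (arc-bound′ u v uv)
        where
        l : ∀ a b c → 7 * a + 11 * b + 11 * c ≡ 7 * (1 * a) + 11 * (1 * b) + 11 * (1 * c)
        l = solve-∀
        r : ∀ a b → 7 * a + 11 * b ≡ 7 * a * 1 + 11 * (1 * b)
        r = solve-∀
      lhs = trans (∑₂-+ _ _) (cong₂ _+_
              (trans (∑₂-+ _ _) (cong₂ _+_
                (trans (∑₂-scale 7 _) (cong (7 *_) arcs-common⁺))
                (trans (∑₂-scale 11 _) (cong (11 *_) arcs-head))))
              (trans (∑₂-scale 11 _) (cong (11 *_) arcs-tail)))
      rhs = trans (∑₂-+ _ _) (cong₂ _+_ (∑₂-scale (7 * h) _)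
              (trans (∑₂-scale 11 _) (cong (11 *_) arcs-common⁻)))

    degree-products : 4 * h * M ≤ 11 * Q
    degree-products = subst₂ _≤_
      (trans (sym (*-∑ (4 * h) din)) (cong (4 * h *_) (sym M-as-indegrees)))
      (sym (*-∑ 11 _)) (∑-mono pointwise)
      where
      assoc′ : ∀ a b → 11 * a * b ≡ 11 * (b * a)
      assoc′ = solve-∀
      pointwise : ∀ u → 4 * h * din u ≤ 11 * (din u * dout u)
      pointwise u with X u in Xu
      ... | true  = ≤-trans (*-monoˡ-≤ (din u) (large u Xu)) (≤-reflexive (assoc′ (dout u) (din u)))
      ... | false rewrite no-in-arcs u Xu = ≤-reflexive (*-zeroʳ (4 * h))

    -- Linearised Cauchy-Schwarz: expand (11 d⁻(v) - 4h)² ≥ 0 and sum over `X`. The tangent point is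
    -- the threshold in-degree 4h/11.
    square-bound : 88 * h * M ≤ 121 * P + 16 * h * h * h
    square-bound = subst₂ _≤_
      (trans (sym (*-∑ (88 * h) din)) (cong (88 * h *_) (sym M-as-indegrees)))
      (trans (∑-+ _ _) (cong₂ _+_ (sym (*-∑ 121 _)) (sym (*-∑ (16 * h * h) _))))
      (∑-mono pointwise)
      where
      l : ∀ x h → 2 * ((11 * x) * (4 * h)) ≡ 88 * h * x
      l = solve-∀
      r : ∀ x h → (11 * x) * (11 * x) + (4 * h) * (4 * h) ≡ 121 * (x * x) + 16 * h * h * 1
      r = solve-∀
      pointwise : ∀ v → 88 * h * din v ≤ 121 * (din v * din v) + 16 * h * h * ⟦ X v ⟧
      pointwise v with X v in Xv
      ... | true  = subst₂ _≤_ (l (din v) h) (r (din v) h) (2ab≤a²+b² (11 * din v) (4 * h))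
      ... | false rewrite no-in-arcs v Xv = ≤-trans (≤-reflexive (*-zeroʳ (88 * h))) z≤n

    many-arcs : 4 * h * h ≤ 11 * M
    many-arcs = subst₂ _≤_ (sym (*-∑ (4 * h) _)) (sym (*-∑ 11 _)) (∑-mono pointwise)
      where
      pointwise : ∀ u → 4 * h * ⟦ X u ⟧ ≤ 11 * dout u
      pointwise u with X u in Xu
      ... | true  = ≤-trans (≤-reflexive (*-identityʳ (4 * h))) (large u Xu)
      ... | false = ≤-trans (≤-reflexive (*-zeroʳ (4 * h))) z≤n

    impossible : 1 ≤ h → ⊥
    impossible 1≤h = arithmetic h M P Q τ 1≤h summed transitive-bound degree-products square-bound many-arcs
      where
      arithmetic : ∀ h M P Q τ → 1 ≤ h → 7 * τ + 11 * P + 11 * Q ≤ 7 * h * M + 11 * τ →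
        2 * τ ≤ P → 4 * h * M ≤ 11 * Q → 88 * h * M ≤ 121 * P + 16 * h * h * h →
        4 * h * h ≤ 11 * M → ⊥
      -- Here `squares` eliminates `τ` and `Q`. Then 121 times `squares`, 9 times `e` and 39h times
      -- `k` cancel `P` and `M`, leaving 156h³ ≤ 144h³.
      arithmetic h@(suc _) M P Q τ _ a b c e k = absurd (cancel (1089 * P + 792 * (h * M))
        (+-mono-≤ (+-mono-≤ (*-monoʳ-≤ 121 squares) (*-monoʳ-≤ 9 e)) (*-monoʳ-≤ (39 * h) k))
        (l₂ h M P) (r₂ h M P))
        where
        l₁ : ∀ h M P Q τ → 7 * τ + 11 * P + 11 * Q + 2 * (2 * τ) + 4 * h * M ≡
             11 * τ + 2 * P + 11 * Q + 4 * (h * M) + 9 * P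
        l₁ = solve-∀
        r₁ : ∀ h M P Q τ → 7 * h * M + 11 * τ + 2 * P + 11 * Q ≡
             11 * τ + 2 * P + 11 * Q + 4 * (h * M) + 3 * (h * M)
        r₁ = solve-∀
        squares : 9 * P ≤ 3 * (h * M)
        squares = cancel (11 * τ + 2 * P + 11 * Q + 4 * (h * M))
          (+-mono-≤ (+-mono-≤ a (*-monoʳ-≤ 2 b)) c) (l₁ h M P Q τ) (r₁ h M P Q τ)
        l₂ : ∀ h M P → 121 * (9 * P) + 9 * (88 * h * M) + 39 * h * (4 * h * h) ≡
             1089 * P + 792 * (h * M) + 156 * (h * h * h)
        l₂ = solve-∀
        r₂ : ∀ h M P → 121 * (3 * (h * M)) + 9 * (121 * P + 16 * h * h * h) + 39 * h * (11 * M) ≡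
             1089 * P + 792 * (h * M) + 144 * (h * h * h)
        r₂ = solve-∀
        absurd : 156 * (h * h * h) ≤ 144 * (h * h * h) → ⊥
        absurd = *-absurd 144 156 (h * h * h) (s≤s z≤n)

-- A vertex of small out-degree in every nonempty set

-- Strong induction on the size of `X`: if no vertex qualifies, `ArcCount` applies to the induced
-- relation, with the induction hypothesis as `smaller`.
small-outdegree : ∀ {n} {E : Fin n → Fin n → Bool} → TriangleFree E → ∀ X → 1 ≤ # X →
  ∃[ x ] (X x ≡ true × 11 * # (λ i → X i ∧ E x i) < 4 * # X)
small-outdegree {n} tf₀ X₀ = go (# X₀) tf₀ X₀ ≤-refl
  where
  -- `E` is quantified anew because the recursive call concerns the induced relation `F`.
  go : ∀ s {E : Fin n → Fin n → Bool} → TriangleFree E → ∀ X → # X ≤ s → 1 ≤ # X →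
    ∃[ x ] (X x ≡ true × 11 * # (λ i → X i ∧ E x i) < 4 * # X)
  go zero    tf X bound 1≤X = ⊥-elim (<-irrefl refl (≤-trans 1≤X bound))
  go (suc s) {E} tf X bound 1≤X
    with any? (λ x → (X x Bool.≟ true) ×-dec (11 * # (λ i → X i ∧ E x i) <? 4 * # X))
  ... | yes found = found
  ... | no  none  = ⊥-elim (ArcCount.impossible tfF X support large smaller 1≤X)
    where
    F : Fin n → Fin n → Bool
    F u v = X u ∧ X v ∧ E u v
    ∧-false₆ : ∀ a b c p q → p ∧ q ≡ false → (a ∧ b ∧ p) ∧ (b ∧ c ∧ q) ≡ false
    ∧-false₆ = toWitness {a? = ∀ᵇ λ a → ∀ᵇ λ b → ∀ᵇ λ c → ∀ᵇ λ p → ∀ᵇ λ q →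
      (p ∧ q Bool.≟ false) →-dec ((a ∧ b ∧ p) ∧ (b ∧ c ∧ q) Bool.≟ false)} _
    arcE : ∀ {u v} → F u v ≡ true → E u v ≡ true
    arcE {u} {v} p = Bool.∧-conicalʳ (X v) _ (Bool.∧-conicalʳ (X u) _ p)
    support : ∀ u v → F u v ≡ true → X u ≡ true × X v ≡ true
    support u v p = Bool.∧-conicalˡ (X u) _ p , Bool.∧-conicalˡ (X v) _ (Bool.∧-conicalʳ (X u) _ p)
    tfF : TriangleFree F
    tfF .no-digon x y = ∧-false₆ (X x) (X y) (X x) (E x y) (E y x) (no-digon tf x y)
    tfF .no-triangle {x} {y} z p =
      ∧-false₆ (X y) (X z) (X x) (E y z) (E z x) (no-triangle tf z (arcE p))
    large : ∀ u → X u ≡ true → 4 * # X ≤ 11 * # (F u)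
    large u Xu = subst (λ b → 4 * # X ≤ 11 * # (λ v → b ∧ X v ∧ E u v)) (sym Xu)
      (≮⇒≥ λ small → none (u , Xu , small))
    smaller : ∀ T → 1 ≤ # T → # T < # X → ArcCount.SmallOutdegree tfF X support T
    smaller T 1≤T T<X = go s tfF T (≤-pred (≤-trans T<X bound)) 1≤T

-- Separations of a triangle-free digraph

-- An indicator sum equal to 1 expresses disjointness and covering in a single equation.
record Separation {n} (E : Fin n → Fin n → Bool) (d : ℕ) (A B S : Fin n → Bool) : Set where
  field
    partition : ∀ i → ⟦ A i ⟧ + ⟦ B i ⟧ + ⟦ S i ⟧ ≡ 1
    no-arc    : ∀ {x} y → A x ≡ true → B y ∧ E x y ≡ false
    outdegree : ∀ x → d ≤ # (E x)
    indegree  : ∀ x → d ≤ # (flip E x)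

open Separation

-- Reversing all arcs exchanges the two sides, so every bound has a dual.
swap : ∀ {n} {E : Fin n → Fin n → Bool} {d A B S} →
       Separation E d A B S → Separation (flip E) d B A S
swap {A = A} {B} {S} sep .partition i =
  trans (cong (_+ ⟦ S i ⟧) (+-comm ⟦ B i ⟧ ⟦ A i ⟧)) (partition sep i)
swap {E = E} {A = A} {B} sep .no-arc {x} y Bx with A y in Ay
... | false = refl
... | true  = trans (sym (cong (_∧ E y x) Bx)) (no-arc sep x Ay)
swap sep .outdegree = indegree sep
swap sep .indegree  = outdegree sep

module _ {n} {E : Fin n → Fin n → Bool} (tf : TriangleFree E) {d} {A B S : Fin n → Bool}
  (sep : Separation E d A B S) where

  outdegree-split : ∀ u → A u ≡ true → d ≤ # (λ i → A i ∧ E u i) + # (λ i → S i ∧ E u i)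
  outdegree-split u Au = ≤-trans (outdegree sep u) (≤-trans
    (∑-mono λ i → pointwise (A i) (B i) (S i) (E u i) (partition sep i) (no-arc sep i Au))
    (≤-reflexive (∑-+ _ _)))
    where
    pointwise : ∀ a b s e → ⟦ a ⟧ + ⟦ b ⟧ + ⟦ s ⟧ ≡ 1 → b ∧ e ≡ false →
                ⟦ e ⟧ ≤ ⟦ a ∧ e ⟧ + ⟦ s ∧ e ⟧
    pointwise = toWitness {a? = ∀ᵇ λ a → ∀ᵇ λ b → ∀ᵇ λ s → ∀ᵇ λ e →
      (⟦ a ⟧ + ⟦ b ⟧ + ⟦ s ⟧ ≟ 1) →-dec (b ∧ e Bool.≟ false) →-dec
      (⟦ e ⟧ ≤? ⟦ a ∧ e ⟧ + ⟦ s ∧ e ⟧)} _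

  -- Inside A ∪ S, the sets N⁻(u) and (N⁺(u) ∩ A) ∪ N⁺(y) are disjoint.
  count-A∪S : ∀ u y → A y ≡ true → E u y ≡ true →
    d + # (λ i → A i ∧ E u i) + d ≤
      # A + # S + # (λ i → (A i ∧ E u i) ∧ E y i) + # (λ i → B i ∧ E i u)
  count-A∪S u y Ay uy = ≤-trans
    (+-mono-≤ (+-monoˡ-≤ (# (λ i → A i ∧ E u i)) (outdegree sep y)) (indegree sep u))
    (subst₂ _≤_ (∑-+₃ _ _ _) (∑-+₄ _ _ _ _)
      (∑-mono λ i → pointwise (A i) (B i) (S i) (E u i) (E y i) (E i u) (partition sep i)
        (no-arc sep i Ay) (no-triangle tf i uy) (no-digon tf u i)))
    where
    pointwise : ∀ a b s eu ey e → ⟦ a ⟧ + ⟦ b ⟧ + ⟦ s ⟧ ≡ 1 →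
      b ∧ ey ≡ false → ey ∧ e ≡ false → eu ∧ e ≡ false →
      ⟦ ey ⟧ + ⟦ a ∧ eu ⟧ + ⟦ e ⟧ ≤ ⟦ a ⟧ + ⟦ s ⟧ + ⟦ (a ∧ eu) ∧ ey ⟧ + ⟦ b ∧ e ⟧
    pointwise = toWitness {a? = ∀ᵇ λ a → ∀ᵇ λ b → ∀ᵇ λ s → ∀ᵇ λ eu → ∀ᵇ λ ey → ∀ᵇ λ e →
      (⟦ a ⟧ + ⟦ b ⟧ + ⟦ s ⟧ ≟ 1) →-dec (b ∧ ey Bool.≟ false) →-dec
      (ey ∧ e Bool.≟ false) →-dec (eu ∧ e Bool.≟ false) →-dec
      (⟦ ey ⟧ + ⟦ a ∧ eu ⟧ + ⟦ e ⟧ ≤? ⟦ a ⟧ + ⟦ s ⟧ + ⟦ (a ∧ eu) ∧ ey ⟧ + ⟦ b ∧ e ⟧)} _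

  -- Inside S, the sets N⁺(u) and N⁻(z) are disjoint.
  count-B∪S : ∀ u z → B z ≡ true → E z u ≡ true →
    d + # (λ i → B i ∧ E i u) + # (λ i → S i ∧ E u i) ≤
      # B + # S + # (λ i → (B i ∧ E i u) ∧ E i z)
  count-B∪S u z Bz zu = ≤-trans
    (+-monoˡ-≤ (# (λ i → S i ∧ E u i)) (+-monoˡ-≤ (# (λ i → B i ∧ E i u)) (indegree sep z)))
    (subst₂ _≤_ (∑-+₃ _ _ _) (∑-+₃ _ _ _)
      (∑-mono λ i → pointwise (A i) (B i) (S i) (E u i) (E i z) (E i u) (partition sep i)
        (no-arc (swap sep) i Bz) (no-triangle tf i zu)))
    where
    pointwise : ∀ a b s eu ez e → ⟦ a ⟧ + ⟦ b ⟧ + ⟦ s ⟧ ≡ 1 →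
      a ∧ ez ≡ false → eu ∧ ez ≡ false →
      ⟦ ez ⟧ + ⟦ b ∧ e ⟧ + ⟦ s ∧ eu ⟧ ≤ ⟦ b ⟧ + ⟦ s ⟧ + ⟦ (b ∧ e) ∧ ez ⟧
    pointwise = toWitness {a? = ∀ᵇ λ a → ∀ᵇ λ b → ∀ᵇ λ s → ∀ᵇ λ eu → ∀ᵇ λ ez → ∀ᵇ λ e →
      (⟦ a ⟧ + ⟦ b ⟧ + ⟦ s ⟧ ≟ 1) →-dec (a ∧ ez Bool.≟ false) →-dec (eu ∧ ez Bool.≟ false) →-dec
      (⟦ ez ⟧ + ⟦ b ∧ e ⟧ + ⟦ s ∧ eu ⟧ ≤? ⟦ b ⟧ + ⟦ s ⟧ + ⟦ (b ∧ e) ∧ ez ⟧)} _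

  order : # A + # B + # S ≡ n
  order = trans (sym (∑-+₃ _ _ _)) (trans (∑-cong (partition sep)) (trans (∑-const n 1) (*-identityʳ n)))

  -- A vertex of small out-degree inside `A` has all its other out-neighbours in `S`.
  A-large : 1 ≤ # A → 11 * d ≤ 4 * # A + 11 * # S
  A-large 1≤A with small-outdegree tf A 1≤A
  ... | u , Au , small = ≤-trans (*-monoʳ-≤ 11 (outdegree-split u Au)) (≤-trans
          (≤-reflexive (*-distribˡ-+ 11 (# (λ i → A i ∧ E u i)) (# (λ i → S i ∧ E u i))))
          (+-mono-≤ (<⇒≤ small)
            (*-monoʳ-≤ 11 (∑-mono λ i → ⟦⟧-mono (Bool.∧-conicalˡ (S i) (E u i))))))

module _ {n} {E : Fin n → Fin n → Bool} (tf : TriangleFree E) {d} {A B S : Fin n → Bool}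
  (sep : Separation E d A B S) (1≤d : 1 ≤ d) (n≤3d : n ≤ 3 * d)
  (S-small : 13 * # S ≤ 9 * d) (1≤A : 1 ≤ # A) (1≤B : 1 ≤ # B) where

  private
    a+b+k≤3d : # A + # B + # S ≤ 3 * d
    a+b+k≤3d = ≤-trans (≤-reflexive (order tf sep)) n≤3d

    -- `small-outdegree` needs R nonempty: otherwise d ≤ k, against k ≤ 9d/13.
    positive-r : ∀ d k r → 1 ≤ d → d ≤ r + k → 13 * k ≤ 9 * d → 1 ≤ r
    positive-r d k (suc r) _ _ _ = s≤s z≤n
    positive-r d k zero 1≤d d≤k p =
      ⊥-elim (*-absurd 9 13 d 1≤d (≤-trans (*-monoʳ-≤ 13 d≤k) p))

    -- T is nonempty too: the lower bound on `b` bounds `a` from above, and with t = 0 the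
    -- inequalities would give k ≥ 105d/149 > 9d/13. Here `r` and `t` stand for the sizes of R and
    -- T, and `c` for the out-degree of `y` in R.
    positive-t : ∀ d a b k r c t → 1 ≤ d → d + r + d ≤ a + k + c + t → 11 * c ≤ 4 * r →
      a + b + k ≤ 3 * d → d ≤ r + k → 11 * d ≤ 4 * b + 11 * k → 13 * k ≤ 9 * d → 1 ≤ t
    positive-t d a b k r c (suc t) _ _ _ _ _ _ _ = s≤s z≤n
    positive-t d a b k r c zero 1≤d p₁ p₂ p₃ p₄ p₅ p₆ =
      ⊥-elim (ratio-absurd 105 149 13 9 d k 1≤d 105d≤149k p₆)
      where
      lhs : ∀ d a b k r c → 44 * (d + r + d) + 4 * (11 * c) + 44 * (a + b + k) +
        28 * d + 11 * (11 * d) ≡ 44 * (r + c + a + b + k + 3 * d) + 105 * d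
      lhs = solve-∀
      rhs : ∀ d a b k r c → 44 * (a + k + c + 0) + 4 * (4 * r) + 44 * (3 * d) +
        28 * (r + k) + 11 * (4 * b + 11 * k) ≡ 44 * (r + c + a + b + k + 3 * d) + 149 * k
      rhs = solve-∀
      105d≤149k : 105 * d ≤ 149 * k
      105d≤149k = cancel (44 * (r + c + a + b + k + 3 * d))
        (+-mono-≤ (+-mono-≤ (+-mono-≤ (+-mono-≤
          (*-monoʳ-≤ 44 p₁) (*-monoʳ-≤ 4 p₂)) (*-monoʳ-≤ 44 p₃)) (*-monoʳ-≤ 28 p₄)) (*-monoʳ-≤ 11 p₅))
        (lhs d a b k r c) (rhs d a b k r c)

    -- The multipliers are chosen to cancel the auxiliary counts `r`, `s`, `c`, `t`, `e`. Here `s`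
    -- counts the out-neighbours of `u` in `S`, and `e` the in-neighbours of `z` in T.
    combine : ∀ d a b k r s c t e → d ≤ r + s → 11 * r ≤ 4 * a → d + r + d ≤ a + k + c + t →
      11 * c ≤ 4 * r → d + t + s ≤ b + k + e → 11 * e ≤ 4 * t →
      4356 * d ≤ 1331 * b + 1135 * a + 2178 * k
    combine d a b k r s c t e p₁ p₂ p₃ p₄ p₅ p₆ =
      cancel (1331 * (t + s + e) + 847 * c + 1639 * r)
        (+-mono-≤ (+-mono-≤ (+-mono-≤ (+-mono-≤ (+-mono-≤
          (*-monoʳ-≤ 1331 p₁) (*-monoʳ-≤ 72 p₂)) (*-monoʳ-≤ 847 p₃))
          (*-monoʳ-≤ 77 p₄)) (*-monoʳ-≤ 1331 p₅)) (*-monoʳ-≤ 121 p₆))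
        (lhs d r s c t e) (rhs a b k r s c t e)
      where
      lhs : ∀ d r s c t e → 1331 * d + 72 * (11 * r) + 847 * (d + r + d) + 77 * (11 * c) +
        1331 * (d + t + s) + 121 * (11 * e) ≡
        1331 * (t + s + e) + 847 * c + 1639 * r + 4356 * d
      lhs = solve-∀
      rhs : ∀ a b k r s c t e → 1331 * (r + s) + 72 * (4 * a) + 847 * (a + k + c + t) +
        77 * (4 * r) + 1331 * (b + k + e) + 121 * (4 * t) ≡
        1331 * (t + s + e) + 847 * c + 1639 * r + (1331 * b + 1135 * a + 2178 * k)
      rhs = solve-∀

    degree-profile : ∃[ r ] ∃[ s ] ∃[ c ] ∃[ t ] ∃[ e ] (d ≤ r + s × 11 * r ≤ 4 * # A ×
      d + r + d ≤ # A + # S + c + t × 11 * c ≤ 4 * r × d + t + s ≤ # B + # S + e × 11 * e ≤ 4 * t)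
    degree-profile =
      let u , Au , r-small = small-outdegree tf A 1≤A
          R = λ i → A i ∧ E u i
          T = λ i → B i ∧ E i u
          d≤r+s = outdegree-split tf sep u Au
          d≤r+k = ≤-trans d≤r+s
            (+-monoʳ-≤ (# R) (∑-mono λ i → ⟦⟧-mono (Bool.∧-conicalˡ (S i) (E u i))))
          y , Ry , c-small = small-outdegree tf R (positive-r d (# S) (# R) 1≤d d≤r+k S-small)
          in-A∪S = count-A∪S tf sep u y (Bool.∧-conicalˡ (A y) _ Ry) (Bool.∧-conicalʳ (A y) _ Ry)
          -- Small in-degree inside T is small out-degree in the reversed digraph.
          z , Tz , e-small = small-outdegree (reverse tf) T
            (positive-t d (# A) (# B) (# S) (# R) _ (# T) 1≤d in-A∪S (<⇒≤ c-small)
              a+b+k≤3d d≤r+k (A-large (reverse tf) (swap sep) 1≤B) S-small)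
          in-B∪S = count-B∪S tf sep u z (Bool.∧-conicalˡ (B z) _ Tz) (Bool.∧-conicalʳ (B z) _ Tz)
      in _ , _ , _ , _ , _ , d≤r+s , <⇒≤ r-small , in-A∪S , <⇒≤ c-small , in-B∪S , <⇒≤ e-small

  separation-bound : 4356 * d ≤ 1331 * # B + 1135 * # A + 2178 * # S
  separation-bound =
    let r , s , c , t , e , p₁ , p₂ , p₃ , p₄ , p₅ , p₆ = degree-profile
    in combine d (# A) (# B) (# S) r s c t e p₁ p₂ p₃ p₄ p₅ p₆

-- Adding the bound and its dual

no-small-separator : ∀ {n} {E : Fin n → Fin n → Bool} → TriangleFree E →
  ∀ {d} {A B S : Fin n → Bool} → Separation E d A B S → 1 ≤ d → n ≤ 3 * d →
  13 * # S ≤ 9 * d → 1 ≤ # A → 1 ≤ # B → ⊥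
no-small-separator tf {d₀} {A} {B} {S} sep 1≤d n≤3d S-small 1≤A 1≤B =
  arithmetic d₀ (# A) (# B) (# S) 1≤d
    (separation-bound tf sep 1≤d n≤3d S-small 1≤A 1≤B)
    (separation-bound (reverse tf) (swap sep) 1≤d n≤3d S-small 1≤B 1≤A)
    (≤-trans (≤-reflexive (order tf sep)) n≤3d) S-small
  where
  arithmetic : ∀ d a b k → 1 ≤ d → 4356 * d ≤ 1331 * b + 1135 * a + 2178 * k →
    4356 * d ≤ 1331 * a + 1135 * b + 2178 * k → a + b + k ≤ 3 * d → 13 * k ≤ 9 * d → ⊥
  -- In the sum of the two bounds, `a` and `b` both have coefficient 2466 = 1331 + 1135, so only a +
  -- b ≤ 3d - k is needed. What remains is 1314d ≤ 1890k, that is k ≥ 73d/105.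
  arithmetic d a b k 1≤d p₁ p₂ p₃ p₄ = ratio-absurd 1314 1890 13 9 d k 1≤d
    (cancel (2466 * (a + b + k + 3 * d))
      (+-mono-≤ (+-mono-≤ p₁ p₂) (*-monoʳ-≤ 2466 p₃)) (lhs d a b k) (rhs d a b k)) p₄
    where
    lhs : ∀ d a b k → 4356 * d + 4356 * d + 2466 * (a + b + k) ≡
      2466 * (a + b + k + 3 * d) + 1314 * d
    lhs = solve-∀
    rhs : ∀ d a b k → (1331 * b + 1135 * a + 2178 * k) + (1331 * a + 1135 * b + 2178 * k) +
      2466 * (3 * d) ≡ 2466 * (a + b + k + 3 * d) + 1890 * k
    rhs = solve-∀

-- Reachability after deleting a vertex set

snoc : ∀ {n} {D : Digraph n} {S x y z} → PathAvoiding D S x y → arc D y z ≡ true → z ∉ S →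
       PathAvoiding D S x z
snoc here         yz z∉S = step yz z∉S here
snoc (step e p q) yz z∉S = step e p (snoc q yz z∉S)

lookup-∉ : ∀ {n} {S : Subset n} {x} → lookup S x ≡ false → x ∉ S
lookup-∉ out x∈S = contradictory ([]=⇒lookup x∈S) out

∉-lookup : ∀ {n} {S : Subset n} {x} → x ∉ S → lookup S x ≡ false
∉-lookup {S = S} {x} x∉S = Bool.¬-not (x∉S ∘ lookup⇒[]= x S)

module Reachability {n} (D : Digraph n) (S : Subset n) (x : Fin n) where

  -- Only soundness: members are reachable from `x`. That nothing further is reachable is expressed
  -- by `Closed`.
  record Reached (A : Fin n → Bool) : Set where
    field
      source : A x ≡ true
      path   : ∀ y → A y ≡ true → PathAvoiding D S x y
      avoids : ∀ y → A y ≡ true → lookup S y ≡ false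

  open Reached public

  Closed : (Fin n → Bool) → Set
  Closed A = ∀ y z → A y ≡ true → A z ≡ false → lookup S z ≡ false → arc D y z ≡ false

  extend : ∀ {A y z} → Reached A → A y ≡ true → arc D y z ≡ true → lookup S z ≡ false →
           Reached (λ i → A i ∨ does (i Fin.≟ z))
  extend rA Ay yz Sz .source rewrite source rA = refl
  extend {A} {z = z} rA Ay yz Sz .path i p with A i in Ai | i Fin.≟ z
  ... | true  | _        = path rA i Ai
  ... | false | yes refl = snoc (path rA _ Ay) yz (lookup-∉ Sz)
  extend {A} {z = z} rA Ay yz Sz .avoids i p with A i in Ai | i Fin.≟ z
  ... | true  | _        = avoids rA i Ai
  ... | false | yes refl = Sz

  -- Starting from `x` alone, the head of an escaping arc is added until none is left. The number of
  -- vertices still outside bounds the rounds.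
  closure : x ∉ S → ∃[ A ] (Reached A × Closed A)
  closure x∉S = grow (# (λ i → not (does (i Fin.≟ x)))) _ ≤-refl start
    where
    start : Reached (λ i → does (i Fin.≟ x))
    start .source with x Fin.≟ x
    ... | yes _  = refl
    ... | no x≢x = ⊥-elim (x≢x refl)
    start .path i p with i Fin.≟ x
    ... | yes refl = here
    start .avoids i p with i Fin.≟ x
    ... | yes refl = ∉-lookup x∉S

    grow : ∀ m A → # (not ∘ A) ≤ m → Reached A → ∃[ A ] (Reached A × Closed A)
    grow m A bound rA
      with any? (λ y → any? λ z → (A y Bool.≟ true) ×-dec (A z Bool.≟ false) ×-dec
                                  (lookup S z Bool.≟ false) ×-dec (arc D y z Bool.≟ true))
    ... | no none = A , rA , λ y z Ay Az Sz → Bool.¬-not λ yz → none (y , z , Ay , Az , Sz , yz)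
    grow zero A bound rA | yes (y , z , Ay , Az , Sz , yz) =
      ⊥-elim (<⇒≱ (#-positive (not ∘ A) {z} (cong not Az)) bound)
    grow (suc m) A bound rA | yes (y , z , Ay , Az , Sz , yz) =
      grow m _ (≤-pred (≤-trans (#-< _ (not ∘ A) (λ i → subset (A i)) {z} (cong not Az) removed) bound))
        (extend rA Ay yz Sz)
      where
      subset : ∀ p {q} → not (p ∨ q) ≡ true → not p ≡ true
      subset false _ = refl
      removed : not (A z ∨ does (z Fin.≟ z)) ≡ false
      removed with z Fin.≟ z
      ... | yes _  = cong not (Bool.∨-zeroʳ (A z))
      ... | no z≢z = ⊥-elim (z≢z refl)

-- From separations to strong connectivity

hasDirectedTriangle? : ∀ {n} (D : Digraph n) → Dec (HasDirectedTriangle D)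
hasDirectedTriangle? D = any? λ x → any? λ y → any? λ z →
  (arc D x y Bool.≟ true) ×-dec (arc D y z Bool.≟ true) ×-dec (arc D z x Bool.≟ true)

triangle-free : ∀ {n} (D : Digraph n) → Oriented D → ¬ HasDirectedTriangle D → TriangleFree (arc D)
triangle-free D oriented none .no-digon x y = Bool.¬-not λ p →
  oriented x y (Bool.∧-conicalˡ _ (arc D y x) p , Bool.∧-conicalʳ (arc D x y) _ p)
triangle-free D oriented none .no-triangle {x} {y} z xy = Bool.¬-not λ p →
  none (x , y , z , xy , Bool.∧-conicalˡ _ (arc D z x) p , Bool.∧-conicalʳ (arc D y z) _ p)

-- If `y` is not reachable from `x` in D - S, the reached set `A` and the remaining vertices outside
-- `S` form a separation with both sides nonempty.
small-set-does-not-disconnect : ∀ {n} {D : Digraph n} {d} → TriangleFree (arc D) →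
  (∀ x → d ≤ outDeg D x × d ≤ inDeg D x) → 1 ≤ d → n ≤ 3 * d →
  ∀ S → 13 * ∣ S ∣ ≤ 9 * d → StronglyConnectedMinus D S
small-set-does-not-disconnect {n} {D} {d} tf degrees 1≤d n≤3d S S-small x y x∉S y∉S
  with Reachability.closure D S x x∉S
... | A , reached , closed with A y in Ay
...   | true  = Reachability.path reached y Ay
...   | false = ⊥-elim (no-small-separator tf sep 1≤d n≤3d
                  (subst (λ s → 13 * s ≤ 9 * d) ∣S∣ S-small)
                  (#-positive A (Reachability.source reached)) (#-positive B By))
  where
  ∣S∣ : ∣ S ∣ ≡ # (lookup S)
  ∣S∣ = trans (cong ∣_∣ (sym (tabulate∘lookup S))) (∣tabulate∣ (lookup S))

  B : Fin n → Bool
  B i = not (A i) ∧ not (lookup S i)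

  By : B y ≡ true
  By rewrite Ay | ∉-lookup y∉S = refl

  sep : Separation (arc D) d A B (lookup S)
  sep .partition i with A i in Ai | lookup S i in Si
  ... | true  | true  = ⊥-elim (contradictory Si (Reachability.avoids reached i Ai))
  ... | true  | false = refl
  ... | false | true  = refl
  ... | false | false = refl
  sep .no-arc {u} v Au with A v in Av | lookup S v in Sv
  ... | true  | _     = refl
  ... | false | true  = refl
  ... | false | false = closed u v Au Av Sv
  sep .outdegree u = ≤-trans (proj₁ (degrees u)) (≤-reflexive (∣tabulate∣ (arc D u)))
  sep .indegree u = ≤-trans (proj₂ (degrees u)) (≤-reflexive (∣tabulate∣ (λ v → arc D v u)))

-- 0.679 is relaxed to 9/13 only to keep the coefficients small.
679/1000≤9/13 : ∀ d k → 1000 * k ≤ 679 * d → 13 * k ≤ 9 * d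
679/1000≤9/13 d k k-small = *-cancelˡ-≤ 1000 (begin
  1000 * (13 * k) ≡⟨ exchange k ⟩
  13 * (1000 * k) ≤⟨ *-monoʳ-≤ 13 k-small ⟩
  13 * (679 * d)  ≡⟨ *-assoc 13 679 d ⟨
  13 * 679 * d    ≤⟨ *-monoˡ-≤ d (toWitness {a? = 13 * 679 ≤? 1000 * 9} _) ⟩
  1000 * 9 * d    ≡⟨ *-assoc 1000 9 d ⟩
  1000 * (9 * d)  ∎)
  where
  open ≤-Reasoning
  exchange : ∀ x → 1000 * (13 * x) ≡ 13 * (1000 * x)
  exchange = solve-∀

theorem1p4 : (d n k : ℕ) (D : Digraph n) → 1 ≤ d → Oriented D → MinSemiDegree D d
    → 291082 * d < 100000 * n → n ≤ 3 * d
    → IsStrongConnectivity D k → 1000 * k ≤ 679 * d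
    → HasDirectedTriangle D
theorem1p4 d n k D 1≤d oriented (degrees , _) _ n≤3d ((S , disconnects , ∣S∣≡k) , _) k-small =
  -- The search for a triangle is finite, so refuting its absence constructively yields one.
  decidable-stable (hasDirectedTriangle? D) λ none →
    disconnects (small-set-does-not-disconnect (triangle-free D oriented none) degrees 1≤d n≤3d S
      (subst (λ s → 13 * s ≤ 9 * d) (sym ∣S∣≡k) (679/1000≤9/13 d k k-small)))
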